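{- For every integer $k$, the class of graphs with layered tree-independence number at most $k$ has independence degeneracy at most $3k$ (that is, every graph with layered tree-independence number at most $k$ has independence degeneracy at most $3k$).
   Context: All graphs are finite, simple and nonnull; $\alpha$ is the independence number. The independence degeneracy of $G$ is the maximum, over all nonnull induced subgraphs $H$ of $G$, of the minimum, over all $v\in V(H)$, of the independence number of the subgraph of $H$ induced by the neighborhood $N_H(v)$. A tree decomposition of $G$ is a pair $(T,\{X_t\}_{t\in V(T)})$ with $T$ a tree and bags $X_t\subseteq V(G)$ such that every vertex is in some bag, both endpoints of every edge lie in a common bag, and for each $u\in V(G)$ the nodes $t$ with $u\in X_t$ induce a connected subgraph of $T$. A layering of $G$ is an ordered partition $(V_0,V_1,\ldots)$ of $V(G)$ (parts may be empty, all but finitely many are) such that for each edge $uv$ with $u\in V_i$, $v\in V_j$ we have $|i-j|\le 1$. The layered tree-independence number of $G$ is the minimum $\ell$ such that there are a tree decomposition and a layering of $G$ with $\alpha(G[X_t\cap V_i])\le\ell$ for every bag $X_t$ and layer $V_i$. -}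

module Defs where

open import Data.Bool.Base using (true; false)
open import Data.Empty using () renaming (⊥ to False; ⊥-elim to False-elim)
open import Data.Fin.Base using (Fin; zero; suc)
open import Data.Fin.Properties using (all?)
open import Data.Fin.Subset using (Subset; inside; outside; _∈_; _⊆_; _∩_; ∣_∣; Nonempty; Empty; ⊤; ⊥)
open import Data.Fin.Subset.Properties using (_∈?_; _⊆?_; nonempty?; x∈p∩q⁺; ∈⊤; ∉⊥; ∣p∣≤n)
open import Data.List.Base using (List; []; _∷_; _++_; _∷ʳ_; map; filter; length; allFin)
open import Data.List.Extrema.Nat using (max; min; max≤v⁺)
open import Data.List.Membership.Propositional using () renaming (_∈_ to _∈ᴸ_)
open import Data.List.Membership.Propositional.Properties using (∈-map⁺; ∈-++⁺ˡ; ∈-++⁺ʳ)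
import Data.List.Relation.Unary.All as All
import Data.List.Relation.Unary.All.Properties as All
open import Data.List.Relation.Unary.Any using (here)
open import Data.List.Relation.Unary.Linked using (Linked; _∷_)
open import Data.List.Relation.Unary.Unique.Propositional using (Unique)
open import Data.Nat.Base using (ℕ; zero; suc; _≤_; z≤n; ∣_-_∣)
open import Data.Nat.Induction using (<-rec)
open import Data.Nat.Properties using (≮⇒≥)
open import Data.Product.Base using (Σ-syntax; ∃-syntax; _×_; _,_)
open import Data.Vec.Base using ([]; _∷_; tabulate)
open import Relation.Binary.Construct.Closure.ReflexiveTransitive using (Star; ε)
open import Relation.Binary.Definitions using (Decidable)
open import Relation.Binary.PropositionalEquality using (_≡_; refl)
open import Relation.Nullary using (¬_; Dec; no; does; _×-dec_; _→-dec_; ¬?)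
open import Relation.Unary using () renaming (Decidable to Decidable₁)

-- The vertex set is an arbitrary subset of Fin n, so that an induced subgraph
-- keeps the names of its vertices.  The vertex set may be empty here (as in
-- the subgraph induced by an empty neighbourhood); being nonnull is a separate
-- predicate.
record Graph (n : ℕ) : Set₁ where
  field
    V        : Subset n
    Adj      : Fin n → Fin n → Set
    adj?     : Decidable Adj
    adj-sym  : ∀ {u v} → Adj u v → Adj v u
    adj-irr  : ∀ {v} → ¬ Adj v v
    adj-V    : ∀ {u v} → Adj u v → u ∈ V

open Graph public

Nonnull : ∀ {n} → Graph n → Set
Nonnull G = Nonempty (V G)

nonnull? : ∀ {n} (G : Graph n) → Dec (Nonnull G)
nonnull? G = nonempty? (V G)

⟦_⟧ : ∀ {n} {P : Fin n → Set} → Decidable₁ P → Subset n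
⟦ P? ⟧ = tabulate (λ x → does (P? x))

infix 8 _[_]

_[_] : ∀ {n} → Graph n → Subset n → Graph n
G [ S ] = record
  { V       = V G ∩ S
  ; Adj     = λ u v → Adj G u v × u ∈ S × v ∈ S
  ; adj?    = λ u v → adj? G u v ×-dec (u ∈? S) ×-dec (v ∈? S)
  ; adj-sym = λ (e , u∈ , v∈) → adj-sym G e , v∈ , u∈
  ; adj-irr = λ (e , _) → adj-irr G e
  ; adj-V   = λ (e , u∈ , _) → x∈p∩q⁺ (adj-V G e , u∈)
  }

N : ∀ {n} → Graph n → Fin n → Subset n
N G v = ⟦ adj? G v ⟧

subsets : ∀ n → List (Subset n)
subsets zero    = [] ∷ []
subsets (suc n) = map (outside ∷_) (subsets n) ++ map (inside ∷_) (subsets n)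

∈-subsets : ∀ {n} (S : Subset n) → S ∈ᴸ subsets n
∈-subsets []          = here refl
∈-subsets (false ∷ S) = ∈-++⁺ˡ (∈-map⁺ (outside ∷_) (∈-subsets S))
∈-subsets {suc n} (true ∷ S) =
  ∈-++⁺ʳ (map (outside ∷_) (subsets n)) (∈-map⁺ (inside ∷_) (∈-subsets S))

Independent : ∀ {n} → Graph n → Subset n → Set
Independent G I = I ⊆ V G × (∀ u v → u ∈ I → v ∈ I → ¬ Adj G u v)

independent? : ∀ {n} (G : Graph n) → Decidable₁ (Independent G)
independent? G I = (I ⊆? V G) ×-dec
  all? λ u → all? λ v → (u ∈? I) →-dec (v ∈? I) →-dec ¬? (adj? G u v)

α : ∀ {n} → Graph n → ℕ
α {n} G = max 0 (map ∣_∣ (filter (independent? G) (subsets n)))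

-- The minimum of α(H[N_H(v)]) over v ∈ V(H).  Every α-value is at most n, so
-- the default value n does not affect the minimum when H is nonnull, which is
-- the only case in which this is used.
minLocalα : ∀ {n} → Graph n → ℕ
minLocalα {n} H =
  min n (map (λ v → α (H [ N H v ])) (filter (_∈? V H) (allFin n)))

-- G [ S ] has vertex set V(G) ∩ S, so, as S runs through all subsets of Fin n,
-- G [ S ] runs through all induced subgraphs of G.
independenceDegeneracy : ∀ {n} → Graph n → ℕ
independenceDegeneracy {n} G =
  max 0 (map (λ S → minLocalα (G [ S ]))
             (filter (λ S → nonnull? (G [ S ])) (subsets n)))

Connected : ∀ {n} → Graph n → Set
Connected G = ∀ {u v} → u ∈ V G → v ∈ V G → Star (Adj G) u v

-- A cycle is a sequence of at least three distinct vertices x ∷ xs, each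
-- adjacent to the next and the last one adjacent to x.
Acyclic : ∀ {n} → Graph n → Set
Acyclic G = ∀ x xs → 2 ≤ length xs → Unique (x ∷ xs) →
            ¬ Linked (Adj G) (x ∷ xs ∷ʳ x)

record IsTree {n} (T : Graph n) : Set where
  field
    nonnull   : Nonnull T
    connected : Connected T
    acyclic   : Acyclic T

-- Only the bags of nodes t ∈ V(T) are meaningful.
record TreeDecomposition {n} (G : Graph n) : Set₁ where
  field
    size          : ℕ
    T             : Graph size
    isTree        : IsTree T
    bag           : Fin size → Subset n
    bag⊆V         : ∀ {t} → t ∈ V T → bag t ⊆ V G
    vertexCovered : ∀ {v} → v ∈ V G → ∃[ t ] (t ∈ V T × v ∈ bag t)
    edgeCovered   : ∀ {u v} → Adj G u v → ∃[ t ] (t ∈ V T × u ∈ bag t × v ∈ bag t)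
    bagsConnected : ∀ {u} → u ∈ V G → Connected (T [ ⟦ (λ t → u ∈? bag t) ⟧ ])

record Layering {n} (G : Graph n) : Set where
  field
    layer         : ℕ → Subset n
    layer⊆V       : ∀ i → layer i ⊆ V G
    layerCovered  : ∀ {v} → v ∈ V G → ∃[ i ] v ∈ layer i
    layerDisjoint : ∀ {v i j} → v ∈ layer i → v ∈ layer j → i ≡ j
    almostEmpty   : ∃[ m ] (∀ i → m ≤ i → Empty (layer i))
    edgeSpan      : ∀ {u v i j} → Adj G u v → u ∈ layer i → v ∈ layer j → ∣ i - j ∣ ≤ 1

LayeredWidthAtMost : ∀ {n} → Graph n → ℕ → Set₁
LayeredWidthAtMost G ℓ =
  Σ[ D ∈ TreeDecomposition G ] Σ[ L ∈ Layering G ]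
    let open TreeDecomposition D
        open Layering L
    in ∀ {t} → t ∈ V T → ∀ i → α (G [ bag t ∩ layer i ]) ≤ ℓ

-- "The layered tree-independence number of G is ℓ".  The minimum ranges over
-- infinitely many decompositions, so it is given as a relation rather than as
-- a function; layeredTreeIndependenceNumber-exists shows that the minimum is
-- attained (up to double negation, which costs nothing
-- when the conclusion drawn from it is decidable).
IsLayeredTreeIndependenceNumber : ∀ {n} → Graph n → ℕ → Set₁
IsLayeredTreeIndependenceNumber G ℓ =
  LayeredWidthAtMost G ℓ × (∀ j → LayeredWidthAtMost G j → ℓ ≤ j)

private
  α≤n : ∀ {n} (G : Graph n) → α G ≤ n
  α≤n {n} G = max≤v⁺ z≤n
    (All.map⁺ (All.universal ∣p∣≤n (filter (independent? G) (subsets n))))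

  K₁ : Graph 1
  K₁ = record
    { V = ⊤ ; Adj = λ _ _ → False ; adj? = λ _ _ → no (λ ())
    ; adj-sym = λ () ; adj-irr = λ () ; adj-V = λ () }

  point-connected : (G : Graph 1) → Connected G
  point-connected G {zero} {zero} _ _ = ε

  K₁-acyclic : Acyclic K₁
  K₁-acyclic x []       ()
  K₁-acyclic x (y ∷ xs) _ _ (() ∷ _)

  trivialDecomposition : ∀ {n} (G : Graph n) → TreeDecomposition G
  trivialDecomposition G = record
    { size          = 1
    ; T             = K₁
    ; isTree        = record
      { nonnull = zero , ∈⊤ ; connected = point-connected K₁ ; acyclic = K₁-acyclic }
    ; bag           = λ _ → V G
    ; bag⊆V         = λ _ v∈ → v∈
    ; vertexCovered = λ v∈ → zero , ∈⊤ , v∈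
    ; edgeCovered   = λ e → zero , ∈⊤ , adj-V G e , adj-V G (adj-sym G e)
    ; bagsConnected = λ {u} _ → point-connected (K₁ [ ⟦ (λ _ → u ∈? V G) ⟧ ])
    }

  trivialLayering : ∀ {n} (G : Graph n) → Layering G
  trivialLayering {n} G = record
    { layer         = layer
    ; layer⊆V       = layer⊆V
    ; layerCovered  = λ v∈ → 0 , v∈
    ; layerDisjoint = λ {_} {i} {j} → disjoint i j
    ; almostEmpty   = 1 , λ { (suc i) _ (_ , v∈) → ∉⊥ v∈ }
    ; edgeSpan      = λ {_} {_} {i} {j} _ → span i j
    }
    where
    layer : ℕ → Subset n
    layer zero    = V G
    layer (suc _) = ⊥
    layer⊆V : ∀ i → layer i ⊆ V G
    layer⊆V zero    v∈ = v∈
    layer⊆V (suc i) v∈ = False-elim (∉⊥ v∈)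
    disjoint : ∀ {v} i j → v ∈ layer i → v ∈ layer j → i ≡ j
    disjoint zero    zero    _  _  = refl
    disjoint zero    (suc j) _  v∈ = False-elim (∉⊥ v∈)
    disjoint (suc i) j       v∈ _  = False-elim (∉⊥ v∈)
    span : ∀ {u v} i j → u ∈ layer i → v ∈ layer j → ∣ i - j ∣ ≤ 1
    span zero    zero    _  _  = z≤n
    span zero    (suc j) _  v∈ = False-elim (∉⊥ v∈)
    span (suc i) j       u∈ _  = False-elim (∉⊥ u∈)

layeredTreeIndependenceNumber-exists :
  ∀ {n} (G : Graph n) → ¬ ¬ (∃[ ℓ ] IsLayeredTreeIndependenceNumber G ℓ)
layeredTreeIndependenceNumber-exists {n} G none =
  <-rec (λ j → ¬ LayeredWidthAtMost G j)
        (λ j smaller wj → none (j , wj , λ i wi → ≮⇒≥ (λ i<j → smaller i<j wi)))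
        n
        (trivialDecomposition G , trivialLayering G ,
         λ {t} _ i → α≤n (G [ V G ∩ Layering.layer (trivialLayering G) i ]))

{-# OPTIONS --safe #-}

-- For an induced subgraph H, prune leaves t of the decomposition tree as long as every
-- vertex of H in the bag of t also occurs in another bag.  It then occurs in the bag of
-- the neighbour of t, so what remains still decomposes H.  When this stops, some vertex v
-- of H occurs only in the bag of a leaf t, which therefore contains all of N_H(v).  As
-- N_H(v) meets at most three layers, an independent subset of it is the union of three
-- sets, each of size at most the layered width.

module Submission where

open import Defs
open import Data.Fin.Base using (Fin; zero; suc)
open import Data.Fin.Properties using (_≟_; any?; all?)
open import Data.Fin.Subset using (Subset; _∈_; _⊆_; _⊂_; _∩_; _∪_; _-_; ∣_∣; ⊤; inside; outside)
open import Data.Fin.Subset.Induction using (⊂-wellFounded)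
open import Data.Fin.Subset.Properties
  using (_∈?_; x∈p∩q⁺; x∈p∩q⁻; p∩q⊆p; x∈p∪q⁺; p─q⊆p; x∈p∧x≢y⇒x∈p-y; x∈p⇒p-x⊂p; p⊆q⇒∣p∣≤∣q∣; ∈⊤)
open import Data.Integer.Base using (ℤ; +_; _*_; _≤_; +≤+)
import Data.Integer.Properties as ℤ
open import Data.List.Base using ([]; _∷_; _++_; _∷ʳ_; length)
open import Data.List.Extrema.Nat using (max≤v⁺; v≤max⁺; min≤v⁺)
open import Data.List.Membership.Propositional using (lose) renaming (_∈_ to _∈ᴸ_)
open import Data.List.Membership.Propositional.Properties
  using (∈-∃++; ∈-map⁺; ∈-filter⁺; ∈-filter⁻; ∈-allFin)
open import Data.List.Properties using (++-assoc)
import Data.List.Relation.Unary.All as All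
import Data.List.Relation.Unary.All.Properties as All
open import Data.List.Relation.Unary.AllPairs using ([]; _∷_)
open import Data.List.Relation.Unary.Any using (here; there)
open import Data.List.Relation.Unary.Linked using (Linked; [-]; _∷_)
open import Data.List.Relation.Unary.Unique.Propositional using (Unique)
open import Data.Nat.Base as ℕ using (ℕ; zero; suc; pred; z≤n; s≤s)
import Data.Nat.Properties as ℕ
open import Data.Product.Base using (∃-syntax; _×_; _,_; proj₁; proj₂)
open import Data.Sum.Base using (_⊎_; inj₁; inj₂)
open import Data.Vec.Base using ([]; _∷_; there)
open import Data.Vec.Properties using (lookup∘tabulate; lookup⇒[]=; []=⇒lookup)
open import Function.Base using (_∘_)
open import Induction.WellFounded using (Acc; acc)
open import Level using (Level)
open import Relation.Binary.Construct.Closure.ReflexiveTransitive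
  using (Star; ε; _◅_) renaming (map to Star-map)
open import Relation.Binary.Core using (Rel)
open import Relation.Binary.PropositionalEquality using (_≡_; _≢_; refl; sym; trans; cong; subst)
open import Relation.Nullary using (yes; no; ¬_; contradiction; ¬?; _×-dec_; _→-dec_)
open import Relation.Nullary.Decidable using (dec-true; decidable-stable)
open import Relation.Unary using () renaming (Decidable to Decidable₁)

private
  variable
    a r : Level
    A : Set a
    n m : ℕ

-- Subsets and lists.

∈⟦⟧⁺ : {P : Fin n → Set} (P? : Decidable₁ P) → ∀ {x} → P x → x ∈ ⟦ P? ⟧
∈⟦⟧⁺ P? {x} p = lookup⇒[]= x _ (trans (lookup∘tabulate _ x) (dec-true (P? x) p))

∈⟦⟧⁻ : {P : Fin n → Set} (P? : Decidable₁ P) → ∀ {x} → x ∈ ⟦ P? ⟧ → P x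
∈⟦⟧⁻ P? {x} x∈ with P? x | trans (sym (lookup∘tabulate _ x)) ([]=⇒lookup x∈)
... | yes p | _ = p
... | no _  | ()

∣p∪q∣≤∣p∣+∣q∣ : (p q : Subset n) → ∣ p ∪ q ∣ ℕ.≤ ∣ p ∣ ℕ.+ ∣ q ∣
∣p∪q∣≤∣p∣+∣q∣ []            []            = z≤n
∣p∪q∣≤∣p∣+∣q∣ (outside ∷ p) (outside ∷ q) = ∣p∪q∣≤∣p∣+∣q∣ p q
∣p∪q∣≤∣p∣+∣q∣ (outside ∷ p) (inside  ∷ q) =
  subst (suc ∣ p ∪ q ∣ ℕ.≤_) (sym (ℕ.+-suc ∣ p ∣ ∣ q ∣)) (s≤s (∣p∪q∣≤∣p∣+∣q∣ p q))
∣p∪q∣≤∣p∣+∣q∣ (inside  ∷ p) (outside ∷ q) = s≤s (∣p∪q∣≤∣p∣+∣q∣ p q)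
∣p∪q∣≤∣p∣+∣q∣ (inside  ∷ p) (inside  ∷ q) =
  s≤s (ℕ.≤-trans (∣p∪q∣≤∣p∣+∣q∣ p q) (ℕ.+-monoʳ-≤ ∣ p ∣ (ℕ.n≤1+n ∣ q ∣)))

x∉p-x : {p : Subset n} → ∀ {x} → ¬ x ∈ p - x
x∉p-x {p = _ ∷ _} {suc _} (there x∈) = x∉p-x x∈

Unique-++⁻ˡ : ∀ xs {ys} → Unique {A = A} (xs ++ ys) → Unique xs
Unique-++⁻ˡ []       _        = []
Unique-++⁻ˡ (x ∷ xs) (px ∷ u) = All.++⁻ˡ xs px ∷ Unique-++⁻ˡ xs u

-- For closing an initial segment of a path into a cycle by an extra edge back to its start.
Linked-++-∷ʳ : {R : Rel A r} → ∀ xs {y z ys} →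
               Linked R (xs ++ y ∷ ys) → R y z → Linked R ((xs ++ y ∷ []) ∷ʳ z)
Linked-++-∷ʳ []           _        Ryz = Ryz ∷ [-]
Linked-++-∷ʳ (x ∷ [])     (Rx ∷ l) Ryz = Rx ∷ Linked-++-∷ʳ [] l Ryz
Linked-++-∷ʳ (x ∷ w ∷ xs) (Rx ∷ l) Ryz = Rx ∷ Linked-++-∷ʳ (w ∷ xs) l Ryz

-- Leaves in acyclic graphs.

-- An edge from `x` to `z` would close the path from `x` to `z` into a cycle, which has at least
-- three nodes because `y` lies between them.
no-chord : (T : Graph m) → Acyclic T → ∀ {x y z xs} → Unique (x ∷ y ∷ xs) →
           Linked (Adj T) (x ∷ y ∷ xs) → z ∈ᴸ xs → ¬ Adj T x z
no-chord T acyclic {x} {y} {z} uniq linked z∈xs xz with ∈-∃++ z∈xs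
... | as , bs , refl =
  acyclic x (y ∷ as ++ z ∷ []) (s≤s (nonempty as))
    (Unique-++⁻ˡ (x ∷ y ∷ as ++ z ∷ [])
      (subst (Unique ∘ (x ∷_) ∘ (y ∷_)) (sym (++-assoc as (z ∷ []) bs)) uniq))
    (Linked-++-∷ʳ (x ∷ y ∷ as) linked (adj-sym T xz))
  where
  nonempty : ∀ as → 1 ℕ.≤ length (as ++ z ∷ [])
  nonempty []      = s≤s z≤n
  nonempty (_ ∷ _) = s≤s z≤n

-- Isolated nodes count as leaves; y is then arbitrary.
Leaf : Graph m → Subset m → Fin m → Set
Leaf T U t = ∃[ y ] (∀ {z} → z ∈ U → Adj T t z → z ≡ y)

-- R contains the nodes off the path and shrinks as the path grows at x.
leaf-from : (T : Graph m) → Acyclic T → (U R : Subset m) → Acc _⊂_ R → ∀ {x y xs} →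
            Unique (x ∷ y ∷ xs) → Linked (Adj T) (x ∷ y ∷ xs) → x ∈ U →
            (∀ z → ¬ z ∈ᴸ (x ∷ y ∷ xs) → z ∈ R) → ∃[ t ] (t ∈ U × Leaf T U t)
leaf-from T acyclic U R (acc rec) {x} {y} {xs} uniq linked x∈U off
  with any? (λ z → (z ∈? U) ×-dec adj? T x z ×-dec ¬? (z ≟ y))
-- The path cannot be extended at `x` inside `U`, so `x` is a leaf.
... | no none = x , x∈U , y , λ {z} z∈U xz →
                  decidable-stable (z ≟ y) (λ z≢y → none (z , z∈U , xz , z≢y))
... | yes (z , z∈U , xz , z≢y) =
  leaf-from T acyclic U (R - z) (rec (x∈p⇒p-x⊂p (off z z∉path)))
    (All.¬Any⇒All¬ _ z∉path ∷ uniq) (adj-sym T xz ∷ linked) z∈U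
    (λ w w∉ → x∈p∧x≢y⇒x∈p-y (off w (w∉ ∘ there)) (w∉ ∘ here))
  where
  z∉path : ¬ z ∈ᴸ (x ∷ y ∷ xs)
  z∉path (here refl)             = adj-irr T xz
  z∉path (there (here z≡y))      = z≢y z≡y
  z∉path (there (there z∈xs))    = no-chord T acyclic uniq linked z∈xs xz

leaf-exists : (T : Graph m) → Acyclic T → (U : Subset m) → ∀ {x} → x ∈ U →
              ∃[ t ] (t ∈ U × Leaf T U t)
leaf-exists T acyclic U {x} x∈U with any? (λ y → (y ∈? U) ×-dec adj? T x y)
... | no none = x , x∈U , x , λ {z} z∈U xz → contradiction (z , z∈U , xz) none
... | yes (y , y∈U , xy) =
  -- A single edge starts the path. Taking every node for `R` makes the condition on the nodes off
  -- the path trivial.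
  leaf-from T acyclic U ⊤ (⊂-wellFounded ⊤)
    (((λ { refl → adj-irr T xy }) All.∷ All.[]) ∷ All.[] ∷ [])
    (xy ∷ [-]) x∈U (λ _ _ → ∈⊤)

-- Pruning a tree decomposition.

-- `P` is a predicate rather than a subset so that a condition such as `z ≢ t` can be added to it
-- directly.
Within : Graph m → (Fin m → Set) → Fin m → Fin m → Set
Within T P s t = Adj T s t × P s × P t

-- Whenever the walk enters `t`, it comes from `y` and must go back to `y`, so these two steps can
-- be cut out.
Star-avoid-leaf : (T : Graph m) {P : Fin m → Set} → ∀ {t y} → (∀ {z} → P z → Adj T t z → z ≡ y) →
                  ∀ {s s′} → s ≢ t → s′ ≢ t → Star (Within T P) s s′ →
                  Star (Within T (λ z → P z × z ≢ t)) s s′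
Star-avoid-leaf T leaf s≢t s′≢t ε = ε
Star-avoid-leaf T {t = t} leaf s≢t s′≢t (_◅_ {j = w} (sw , Ps , Pw) path) with w ≟ t
... | no w≢t = (sw , (Ps , s≢t) , (Pw , w≢t)) ◅ Star-avoid-leaf T leaf w≢t s′≢t path
Star-avoid-leaf T leaf s≢t s′≢t ((st , Ps , Pt) ◅ ε) | yes refl = contradiction refl s′≢t
Star-avoid-leaf T leaf s≢t s′≢t ((st , Ps , Pt) ◅ (tc , _ , Pc) ◅ path) | yes refl
  with refl ← trans (leaf Pc tc) (sym (leaf Ps (adj-sym T st)))
  = Star-avoid-leaf T leaf s≢t s′≢t path

-- Pruning changes only `U`. The bags are not intersected with `V H`, so those of a decomposition of
-- `G` serve all induced subgraphs of `G`.
record Decomposes (H : Graph n) (T : Graph m) (bag : Fin m → Subset n) (U : Subset m) : Set where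
  field
    vertex : ∀ {v} → v ∈ V H → ∃[ t ] (t ∈ U × v ∈ bag t)
    edge   : ∀ {u v} → Adj H u v → ∃[ t ] (t ∈ U × u ∈ bag t × v ∈ bag t)
    path   : ∀ {v s t} → v ∈ V H → s ∈ U → t ∈ U → v ∈ bag s → v ∈ bag t →
             Star (Within T (λ r → r ∈ U × v ∈ bag r)) s t

module _ {H : Graph n} {T : Graph m} {bag : Fin m → Subset n} where

  prune : ∀ {U t} → Leaf T U t → Decomposes H T bag U →
          (∀ {v} → v ∈ V H → v ∈ bag t → ∃[ s ] (s ∈ U × v ∈ bag s × s ≢ t)) → t ∈ U →
          Decomposes H T bag (U - t)
  prune {U} {t} (y , leaf) D elsewhere t∈U = record { vertex = vertex′ ; edge = edge′ ; path = path′ }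
    where
    open Decomposes D

    in-neighbour : ∀ {v} → v ∈ V H → v ∈ bag t → y ∈ U - t × v ∈ bag y
    in-neighbour v∈H v∈t with elsewhere v∈H v∈t
    ... | s , s∈U , v∈s , s≢t with path v∈H t∈U s∈U v∈t v∈s
    ...   | ε = contradiction refl s≢t
    -- The walk from `t` to `s` stays in bags containing `v`. Its first step can only go to `y`, so
    -- the bag of `y` contains `v`.
    ...   | (tw , _ , w∈U , v∈w) ◅ _ with refl ← leaf w∈U tw =
      x∈p∧x≢y⇒x∈p-y w∈U (λ { refl → adj-irr T tw }) , v∈w

    vertex′ : ∀ {v} → v ∈ V H → ∃[ s ] (s ∈ U - t × v ∈ bag s)
    vertex′ v∈H with vertex v∈H
    ... | s , s∈U , v∈s with s ≟ t
    ...   | yes refl = y , in-neighbour v∈H v∈s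
    ...   | no s≢t   = s , x∈p∧x≢y⇒x∈p-y s∈U s≢t , v∈s

    edge′ : ∀ {u v} → Adj H u v → ∃[ s ] (s ∈ U - t × u ∈ bag s × v ∈ bag s)
    edge′ uv with edge uv
    ... | s , s∈U , u∈s , v∈s with s ≟ t
    ...   | no s≢t   = s , x∈p∧x≢y⇒x∈p-y s∈U s≢t , u∈s , v∈s
    -- An edge covered by the bag of `t` passes to the bag of `y`, where both its ends reappear.
    ...   | yes refl =
      let y∈ , u∈y = in-neighbour (adj-V H uv) u∈s
          _  , v∈y = in-neighbour (adj-V H (adj-sym H uv)) v∈s
      in y , y∈ , u∈y , v∈y

    path′ : ∀ {v s s′} → v ∈ V H → s ∈ U - t → s′ ∈ U - t → v ∈ bag s → v ∈ bag s′ →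
            Star (Within T (λ r → r ∈ U - t × v ∈ bag r)) s s′
    path′ {v} v∈H s∈ s′∈ v∈s v∈s′ =
      Star-map (λ (e , p , q) → e , keep p , keep q)
        -- `t` is also a leaf among the nodes whose bags contain `v`, so the walk can avoid it.
        (Star-avoid-leaf T (λ (z∈U , _) → leaf z∈U) (≢t s∈) (≢t s′∈)
          (path v∈H (p─q⊆p _ _ s∈) (p─q⊆p _ _ s′∈) v∈s v∈s′))
      where
      keep : ∀ {r} → (r ∈ U × v ∈ bag r) × r ≢ t → r ∈ U - t × v ∈ bag r
      keep ((r∈U , v∈r) , r≢t) = x∈p∧x≢y⇒x∈p-y r∈U r≢t , v∈r
      ≢t : ∀ {r} → r ∈ U - t → r ≢ t
      ≢t r∈ refl = x∉p-x r∈

  -- Induction on `U`. The vertex `v₀` always lies in some remaining bag, so `U` cannot run empty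
  -- before a vertex confined to the bag of a leaf is found.
  neighbourhood-in-bag : Acyclic T → Nonnull H → ∀ U → Acc _⊂_ U → Decomposes H T bag U →
    ∃[ v ] ∃[ t ] (v ∈ V H × t ∈ U × (∀ {u} → Adj H v u → u ∈ bag t))
  neighbourhood-in-bag acyclic (v₀ , v₀∈H) U (acc rec) D
    with t₀ , t₀∈U , _ ← Decomposes.vertex D v₀∈H
    with t , t∈U , leaf ← leaf-exists T acyclic U t₀∈U
    with any? (λ v → (v ∈? V H) ×-dec (v ∈? bag t) ×-dec
                     all? (λ s → (s ∈? U) →-dec (v ∈? bag s) →-dec (s ≟ t)))
  ... | yes (v , v∈H , v∈t , only) = v , t , v∈H , t∈U , λ vu →
    -- The bag that covers the edge `vu` contains `v`, and among the nodes of `U` only `t` has such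
    -- a bag.
    let s , s∈U , v∈s , u∈s = Decomposes.edge D vu
    in subst (λ r → _ ∈ bag r) (only s s∈U v∈s) u∈s
  ... | no none =
    let v , s , v∈H , s∈ , N⊆ = neighbourhood-in-bag acyclic (v₀ , v₀∈H) (U - t) (rec (x∈p⇒p-x⊂p t∈U))
                                  (prune leaf D elsewhere t∈U)
    in v , s , v∈H , p─q⊆p _ _ s∈ , N⊆
    where
    elsewhere : ∀ {v} → v ∈ V H → v ∈ bag t → ∃[ s ] (s ∈ U × v ∈ bag s × s ≢ t)
    elsewhere {v} v∈H v∈t with any? (λ s → (s ∈? U) ×-dec (v ∈? bag s) ×-dec ¬? (s ≟ t))
    ... | yes found = found
    ... | no absent = contradiction (v , v∈H , v∈t , λ s s∈U v∈s →
            decidable-stable (s ≟ t) (λ s≢t → absent (s , s∈U , v∈s , s≢t))) none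

-- The pruning starts here, with all nodes of the tree. `G [ S ]` has no more vertices and edges to
-- cover than `G`, so the decomposition of `G` serves unchanged.
decomposes-induced : {G : Graph n} (D : TreeDecomposition G) (S : Subset n) →
  let open TreeDecomposition D in Decomposes (G [ S ]) T bag (V T)
decomposes-induced {G = G} D S = record
  { vertex = vertexCovered ∘ ∈G
  ; edge   = edgeCovered ∘ proj₁
  ; path   = λ {v} v∈ s∈ t∈ v∈s v∈t →
      Star-map
        -- Adjacency in the induced subgraph of `T` records only the bag condition; membership in
        -- `V T` comes from the edge itself.
        (λ (e , s∈′ , t∈′) → e , (adj-V T e , ∈⟦⟧⁻ (bags? v) s∈′) ,
                                 (adj-V T (adj-sym T e) , ∈⟦⟧⁻ (bags? v) t∈′))
        (bagsConnected (∈G v∈) (x∈p∩q⁺ (s∈ , ∈⟦⟧⁺ (bags? v) v∈s))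
                               (x∈p∩q⁺ (t∈ , ∈⟦⟧⁺ (bags? v) v∈t)))
  }
  where
  open TreeDecomposition D
  ∈G : ∀ {v} → v ∈ V G ∩ S → v ∈ V G
  ∈G = p∩q⊆p (V G) S
  bags? : ∀ v → Decidable₁ (λ r → v ∈ bag r)
  bags? v r = v ∈? bag r

-- Bounds on independence numbers and degeneracy.

α-upper : (G : Graph n) {b : ℕ} → (∀ {I} → Independent G I → ∣ I ∣ ℕ.≤ b) → α G ℕ.≤ b
α-upper {n} G bound = max≤v⁺ z≤n
  (All.map⁺ (All.tabulate (λ I∈ → bound (proj₂ (∈-filter⁻ (independent? G) {xs = subsets n} I∈)))))

∣independent∣≤α : (G : Graph n) {I : Subset n} → Independent G I → ∣ I ∣ ℕ.≤ α G
∣independent∣≤α G {I} indep = v≤max⁺ 0 _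
  (inj₂ (lose (∈-map⁺ ∣_∣ (∈-filter⁺ (independent? G) (∈-subsets I) indep)) ℕ.≤-refl))

minLocalα≤ : (H : Graph n) → ∀ {v} → v ∈ V H → minLocalα H ℕ.≤ α (H [ N H v ])
minLocalα≤ {n} H {v} v∈H = min≤v⁺ n _
  (inj₂ (lose (∈-map⁺ (λ v → α (H [ N H v ])) (∈-filter⁺ (_∈? V H) (∈-allFin v) v∈H)) ℕ.≤-refl))

independenceDegeneracy≤ : (G : Graph n) {b : ℕ} →
  (∀ S → Nonnull (G [ S ]) → minLocalα (G [ S ]) ℕ.≤ b) → independenceDegeneracy G ℕ.≤ b
independenceDegeneracy≤ {n} G bound = max≤v⁺ z≤n
  (All.map⁺ (All.tabulate (λ {S} S∈ →
    bound S (proj₂ (∈-filter⁻ (λ S → nonnull? (G [ S ])) {xs = subsets n} S∈)))))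

-- Layers around a vertex.

-- For i = 0 the first two alternatives coincide.
∣i-j∣≤1 : ∀ i j → ℕ.∣ i - j ∣ ℕ.≤ 1 → j ≡ pred i ⊎ j ≡ i ⊎ j ≡ suc i
∣i-j∣≤1 zero          zero          _ = inj₁ refl
∣i-j∣≤1 zero          (suc zero)    _ = inj₂ (inj₂ refl)
∣i-j∣≤1 zero          (suc (suc j)) (s≤s ())
∣i-j∣≤1 (suc zero)    zero          _ = inj₁ refl
∣i-j∣≤1 (suc (suc i)) zero          (s≤s ())
∣i-j∣≤1 (suc i)       (suc j)       d with ∣i-j∣≤1 i j d
∣i-j∣≤1 (suc zero)    (suc j)       d | inj₁ refl = inj₂ (inj₁ refl)
∣i-j∣≤1 (suc (suc i)) (suc j)       d | inj₁ refl = inj₁ refl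
... | inj₂ (inj₁ refl) = inj₂ (inj₁ refl)
... | inj₂ (inj₂ refl) = inj₂ (inj₂ refl)

-- The minimum is at most its value at the vertex whose neighbourhood lies in one bag. The factor 3
-- counts the layers that can meet this neighbourhood.
minLocalα-induced≤ : (G : Graph n) {ℓ : ℕ} → LayeredWidthAtMost G ℓ →
                     ∀ S → Nonnull (G [ S ]) → minLocalα (G [ S ]) ℕ.≤ 3 ℕ.* ℓ
minLocalα-induced≤ G {ℓ} (D , L , width) S nonnull
  with v , t , v∈H , t∈T , N⊆bag ← neighbourhood-in-bag (IsTree.acyclic (TreeDecomposition.isTree D))
         nonnull _ (⊂-wellFounded _) (decomposes-induced D S)
  with i , v∈i ← Layering.layerCovered L (p∩q⊆p _ S v∈H)
  = ℕ.≤-trans (minLocalα≤ H v∈H) (α-upper (H [ N H v ]) bound)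
  where
  open TreeDecomposition D
  open Layering L
  H = G [ S ]

  module _ {I} (indep : Independent (H [ N H v ]) I) where

    ∈H∩N : ∀ {u} → u ∈ I → u ∈ V H × u ∈ N H v
    ∈H∩N u∈I = x∈p∩q⁻ (V H) (N H v) (proj₁ indep u∈I)

    ∈S : ∀ {u} → u ∈ I → u ∈ S
    ∈S u∈I = proj₂ (x∈p∩q⁻ (V G) S (proj₁ (∈H∩N u∈I)))

    adjacent : ∀ {u} → u ∈ I → Adj H v u
    adjacent u∈I = ∈⟦⟧⁻ (adj? H v) (proj₂ (∈H∩N u∈I))

    slice-independent : ∀ j → Independent (G [ bag t ∩ layer j ]) (I ∩ layer j)
    -- An edge of `G` between members of `I` is also an edge of `H [ N H v ]`, since both ends lie
    -- in `S` and in `N H v`; this contradicts `indep`.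
    slice-independent j = ⊆V , λ u w u∈ w∈ (uw , _) →
      let u∈I = ∈I u∈ ; w∈I = ∈I w∈ in
      proj₂ indep u w u∈I w∈I
        ((uw , ∈S u∈I , ∈S w∈I) , proj₂ (∈H∩N u∈I) , proj₂ (∈H∩N w∈I))
      where
      ∈I : ∀ {u} → u ∈ I ∩ layer j → u ∈ I
      ∈I = p∩q⊆p I (layer j)
      ⊆V : I ∩ layer j ⊆ V G ∩ (bag t ∩ layer j)
      ⊆V u∈ = let u∈I , u∈j = x∈p∩q⁻ I (layer j) u∈ in
        x∈p∩q⁺ (layer⊆V j u∈j , x∈p∩q⁺ (N⊆bag (adjacent u∈I) , u∈j))

    ∣slice∣≤ℓ : ∀ j → ∣ I ∩ layer j ∣ ℕ.≤ ℓ
    ∣slice∣≤ℓ j = ℕ.≤-trans (∣independent∣≤α (G [ bag t ∩ layer j ]) (slice-independent j)) (width t∈T j)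

    slices : Subset _
    -- If `i` is 0, then `pred i` is `i` and one slice appears twice, which is harmless for an upper
    -- bound.
    slices = (I ∩ layer (pred i)) ∪ ((I ∩ layer i) ∪ (I ∩ layer (suc i)))

    I⊆slices : I ⊆ slices
    I⊆slices {u} u∈I with layerCovered (p∩q⊆p _ S (proj₁ (∈H∩N u∈I)))
    -- `u` is a neighbour of `v`, so its layer is at most one away from layer `i`.
    ... | j , u∈j with ∣i-j∣≤1 i j (edgeSpan (proj₁ (adjacent u∈I)) v∈i u∈j)
    ...   | inj₁ refl        = x∈p∪q⁺ (inj₁ (x∈p∩q⁺ (u∈I , u∈j)))
    ...   | inj₂ (inj₁ refl) = x∈p∪q⁺ (inj₂ (x∈p∪q⁺ (inj₁ (x∈p∩q⁺ (u∈I , u∈j)))))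
    ...   | inj₂ (inj₂ refl) = x∈p∪q⁺ (inj₂ (x∈p∪q⁺ (inj₂ (x∈p∩q⁺ (u∈I , u∈j)))))

    bound : ∣ I ∣ ℕ.≤ 3 ℕ.* ℓ
    bound = begin
      ∣ I ∣                                         ≤⟨ p⊆q⇒∣p∣≤∣q∣ I⊆slices ⟩
      ∣ slices ∣                                    ≤⟨ ∣p∪q∣≤∣p∣+∣q∣ (I ∩ layer (pred i)) _ ⟩
      ∣ I ∩ layer (pred i) ∣ ℕ.+ ∣ (I ∩ layer i) ∪ (I ∩ layer (suc i)) ∣
        ≤⟨ ℕ.+-mono-≤ (∣slice∣≤ℓ (pred i)) (∣p∪q∣≤∣p∣+∣q∣ (I ∩ layer i) _) ⟩
      ℓ ℕ.+ (∣ I ∩ layer i ∣ ℕ.+ ∣ I ∩ layer (suc i) ∣)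
        ≤⟨ ℕ.+-monoʳ-≤ ℓ (ℕ.+-mono-≤ (∣slice∣≤ℓ i) (∣slice∣≤ℓ (suc i))) ⟩
      ℓ ℕ.+ (ℓ ℕ.+ ℓ)                               ≡⟨ cong (λ m → ℓ ℕ.+ (ℓ ℕ.+ m)) (ℕ.+-identityʳ ℓ) ⟨
      3 ℕ.* ℓ                                       ∎
      where open ℕ.≤-Reasoning

lemma6p1 : ∀ (k : ℤ) {n : ℕ} (G : Graph n) → Nonnull G →
    (ℓ : ℕ) → IsLayeredTreeIndependenceNumber G ℓ → + ℓ ≤ k →
    + independenceDegeneracy G ≤ + 3 * k
lemma6p1 k G _ ℓ (width , _) ℓ≤k = begin
  -- The decomposition and layering that attain `ℓ` give the bound over the natural numbers; the
  -- integer `k` enters only in the last inequality.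
  + independenceDegeneracy G  ≤⟨ +≤+ (independenceDegeneracy≤ G (minLocalα-induced≤ G width)) ⟩
  + (3 ℕ.* ℓ)                 ≡⟨ ℤ.pos-* 3 ℓ ⟩
  + 3 * + ℓ                   ≤⟨ ℤ.*-monoˡ-≤-nonNeg (+ 3) ℓ≤k ⟩
  + 3 * k                     ∎
  where open ℤ.≤-Reasoning
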